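{- Let $f \colon A^n \to B$, and assume that $n > \max(|A|, 3)$ and $f$ is determined by $\operatorname{oddsupp}$. Then the function $f$ is reconstructible.
   Context: $A$ and $B$ are sets with at least two elements; $n$ is a positive integer. $[n] := \{1,\dots,n\}$, $\binom{[n]}{2}$ denotes the set of all $2$-element subsets of $[n]$, and $\Sigma_n$ is the symmetric group on $[n]$. For $\mathbf{a} \in A^n$ and $\sigma \colon [m] \to [n]$, write $\mathbf{a}\sigma := (a_{\sigma(1)},\dots,a_{\sigma(m)}) \in A^m$. Functions $f, g \colon A^n \to B$ are equivalent, $f \equiv g$, if there is $\sigma \in \Sigma_n$ with $f(\mathbf{a}) = g(\mathbf{a}\sigma)$ for all $\mathbf{a} \in A^n$. For $n \geq 2$, $f \colon A^n \to B$ and $I \in \binom{[n]}{2}$, the identification minor $f_I \colon A^{n-1} \to B$ is given by $f_I(\mathbf{a}) = f(\mathbf{a}\delta_I)$, where $\delta_I \colon [n] \to [n-1]$ is defined by $\delta_I(i) = i$ if $i < \max I$, $\delta_I(i) = \min I$ if $i = \max I$, and $\delta_I(i) = i-1$ if $i > \max I$. The deck of $f$, $\operatorname{deck} f$, is the multiset $\{f_I/{\equiv} : I \in \binom{[n]}{2}\}$ of equivalence classes. A function $g \colon A^n \to B$ is a reconstruction of $f$ if $\operatorname{deck} f = \operatorname{deck} g$. The function $f$ is reconstructible if it is equivalent to all of its reconstructions. $\mathcal{P}(A)$ is the power set of $A$ and $\operatorname{oddsupp}(a_1,\dots,a_n) := \{a \in A : |\{i \in [n] : a_i = a\}| \text{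 is odd}\}$. A function $f \colon A^n \to B$ is determined by $\operatorname{oddsupp}$ if there exists $f^* \colon \mathcal{P}(A) \to B$ such that $f = f^* \circ \operatorname{oddsupp}|_{A^n}$. -}

module Defs where

open import Data.Bool.Base using (Bool)
open import Data.Fin.Base using (Fin; toℕ; fromℕ<) renaming (_<_ to _<ᶠ_)
open import Data.Fin.Properties using (<-cmp; toℕ<n)
open import Data.Fin.Permutation using (Permutation′; _⟨$⟩ʳ_)
open import Data.Nat.Base using (ℕ; _∸_; _<_; z≤n; parity)
open import Data.Nat.Properties using (∸-monoˡ-<; <-≤-trans; <⇒≤pred; ≤-<-trans)
open import Data.Parity.Base using (1ℙ)
open import Data.Parity.Properties using () renaming (_≟_ to _≟ℙ_)
open import Data.Product.Base using (Σ-syntax; _×_)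
open import Data.Vec.Base using (Vec; lookup; tabulate; count)
open import Function.Base using (_∘_)
open import Function.Bundles using (_↔_; Inverse)
open import Level using (Level)
open import Relation.Binary.Definitions using (DecidableEquality; tri<; tri≈; tri>)
open import Relation.Binary.PropositionalEquality using (_≡_; _≗_)
open import Relation.Nullary.Decidable using (does)

private
  variable
    a b : Level
    A : Set a
    B : Set b
    m n : ℕ

infixl 8 _·_
infix 4 _≃_ _≈ᵈ_

_·_ : Vec A n → (Fin m → Fin n) → Vec A m
u · σ = tabulate (lookup u ∘ σ)

_≃_ : (f g : Vec A n → B) → Set _
_≃_ {n = n} f g = Σ[ σ ∈ Permutation′ n ] (∀ u → f u ≡ g (u · (σ ⟨$⟩ʳ_)))

-- A two-element subset of Fin n, given by its minimum and maximum; the proof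
-- of the inequality is unique, so subsets correspond one-to-one to elements.
record TwoSubset (n : ℕ) : Set where
  constructor twoSubset
  field
    min max : Fin n
    min<max : min <ᶠ max

open TwoSubset public

private
  below : ∀ {n} {i j : Fin n} → i <ᶠ j → toℕ i < n ∸ 1
  below {j = j} i<j = <-≤-trans i<j (<⇒≤pred (toℕ<n j))

  above : ∀ {n} {i j : Fin n} → j <ᶠ i → toℕ i ∸ 1 < n ∸ 1
  above {i = i} j<i = ∸-monoˡ-< (toℕ<n i) (≤-<-trans z≤n j<i)

-- Indices start at 0 rather than 1, which leaves the defining formula of δ_I
-- unchanged.
δ : TwoSubset n → Fin n → Fin (n ∸ 1)
δ I i with <-cmp i (max I)
... | tri< i<max _ _ = fromℕ< {toℕ i} (below i<max)
... | tri≈ _ _ _     = fromℕ< {toℕ (min I)} (below (min<max I))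
... | tri> _ _ i>max = fromℕ< {toℕ i ∸ 1} (above i>max)

minor : (Vec A n → B) → TwoSubset n → Vec A (n ∸ 1) → B
minor f I u = f (u · δ I)

-- The multiset of ≃-classes of the minors, presented as a family of
-- representatives indexed by the two-element subsets.
deck : (Vec A n → B) → TwoSubset n → (Vec A (n ∸ 1) → B)
deck = minor

-- Two indexed families present the same multiset of ≃-classes when some
-- bijection of the index sets matches equivalent members.
_≈ᵈ_ : (D E : TwoSubset n → (Vec A m → B)) → Set _
_≈ᵈ_ {n = n} D E =
  Σ[ π ∈ TwoSubset n ↔ TwoSubset n ] (∀ I → D I ≃ E (Inverse.to π I))

_IsReconstructionOf_ : (g f : Vec A n → B) → Set _
g IsReconstructionOf f = deck f ≈ᵈ deck g

Reconstructible : (Vec A n → B) → Set _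
Reconstructible f = ∀ g → g IsReconstructionOf f → f ≃ g

-- Subsets are given by characteristic functions.
𝒫 : Set a → Set a
𝒫 A = A → Bool

oddsupp : DecidableEquality A → Vec A n → 𝒫 A
oddsupp _≟_ u x = does (parity (count (_≟ x) u) ≟ℙ 1ℙ)

-- Equality of subsets is pointwise equality _≗_ of characteristic functions;
-- without function extensionality, f* has to be required to respect it.
DeterminedByOddsupp : DecidableEquality A → (Vec A n → B) → Set _
DeterminedByOddsupp {A = A} {B = B} _≟_ f =
  Σ[ f* ∈ (𝒫 A → B) ]
    (∀ {S T} → S ≗ T → f* S ≡ f* T) × (∀ u → f u ≡ f* (oddsupp _≟_ u))

{-# OPTIONS --safe #-}

-- If f is determined by oddsupp, then in each minor of f the identified argument is
-- inessential. Hence every minor g_{ij} of a reconstruction g has an inessential argument q: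
-- for tuples u with u i = u j, the value g u is that of f after u i is replaced by u q. If
-- q ∈ {i , j}, then g u = f u for these tuples, and since n > |A| every tuple repeats a value
-- somewhere. Suppose instead that q ∉ {i , j}. On tuples with two coincidences the
-- descriptions of g by two minors must agree, and playing off the minors on at most five
-- arguments against each other shows that, in the presence of a coincidence, f does not
-- notice when one of the other arguments is replaced by another. This again gives g u = f u.
-- Equality in B need not be decidable, so the argument never asks whether f is constant.
module Submission where

open import Defs
open import Level using (Level)
open import Data.Nat.Base using (ℕ; _<_; _⊔_)
open import Data.Fin.Base using (Fin)
open import Data.Fin.Properties using (inj⇒≟)
open import Data.Product.Base using (∃₂)
open import Data.Vec.Base using (Vec)
open import Function.Bundles using (_↔_)
open import Function.Properties.Inverse using (↔⇒↣)
open import Relation.Binary.PropositionalEquality using (_≢_)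

open import Algebra.Properties.CommutativeMonoid.Sum using (sum; sum-permute; sum-remove; sum-cong-≗)
import Algebra.Solver.Ring.AlmostCommutativeRing as ACR
import Algebra.Solver.Ring.Simple as RingSolver
open import Data.Bool.Base using (true; false)
open import Data.Fin.Base using (zero; suc; toℕ; punchIn; punchOut; _↑ˡ_) renaming (_<_ to _<ᶠ_)
open import Data.Fin.Patterns using (0F; 1F; 2F; 3F)
open import Data.Fin.Permutation
  using (Permutation′; _⟨$⟩ʳ_; _⟨$⟩ˡ_; inverseˡ; inverseʳ; flip;
         insert; insert-punchIn; transpose; id)
open import Data.Fin.Properties
  using (<-cmp; <⇒≢; toℕ-injective; toℕ-fromℕ<; punchIn-punchOut; punchInᵢ≢i;
         punchOut-injective; pigeonhole)
  renaming (_≟_ to _≟ᶠ_)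
open import Data.Nat.Base using (zero; suc; _+_; _∸_; s≤s; z≤n; s<s⁻¹; parity)
open import Data.Nat.Properties using (m⊔n<o⇒m<o; m⊔n<o⇒n<o; <-irrefl)
open import Data.Parity.Base as ℙ using (Parity; 1ℙ)
open import Data.Parity.Properties as ℙ using ()
open import Data.Product.Base using (∃; _,_; proj₁; proj₂)
open import Data.Vec.Base using ([]; _∷_; lookup; tabulate; count; _[_]≔_)
open import Data.Vec.Membership.DecPropositional using (_∈?_)
open import Data.Vec.Membership.Propositional using (_∈_)
open import Data.Vec.Properties
  using (tabulate∘lookup; tabulate-cong; lookup∘tabulate; lookup∘update; lookup∘update′; []≔-lookup)
open import Data.Vec.Relation.Unary.All using ([]; _∷_)
open import Data.Vec.Relation.Unary.AllPairs using ([]; _∷_; allPairs?)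
open import Data.Vec.Relation.Unary.Any using (here; there)
open import Data.Vec.Relation.Unary.Unique.Propositional using (Unique)
open import Data.Vec.Relation.Unary.Unique.Propositional.Properties using (lookup-injective)
open import Function.Base using (_∘_; case_of_)
open import Function.Bundles using (Inverse; Injection)
open import Relation.Binary.Definitions using (DecidableEquality; tri<; tri≈; tri>)
open import Relation.Binary.PropositionalEquality
  using (_≡_; refl; sym; trans; cong; cong₂; subst; subst₂; ≢-sym; module ≡-Reasoning)
open import Relation.Nullary.Decidable using (yes; no; does; True; toWitness; ¬?)
open import Relation.Nullary.Negation using (contradiction)

-- The coefficients are parities themselves, so the solver cancels any term that occurs twice.
module ℙ-Solver = RingSolver (ACR.fromCommutativeRing ℙ.+-*-commutativeRing) ℙ._≟_

private
  variable
    a b : Level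
    m n : ℕ

Σℙ : (Fin n → Parity) → Parity
Σℙ = sum ℙ.+-0-commutativeMonoid

-- The identification map `δ` and its section `punchIn (max I)`.

toℕ-punchIn-< : ∀ (i : Fin (suc n)) j → punchIn i j <ᶠ i → toℕ (punchIn i j) ≡ toℕ j
toℕ-punchIn-< (suc i) zero    _ = refl
toℕ-punchIn-< (suc i) (suc j) p = cong suc (toℕ-punchIn-< i j (s<s⁻¹ p))

toℕ-punchIn-> : ∀ (i : Fin (suc n)) j → i <ᶠ punchIn i j → toℕ (punchIn i j) ≡ suc (toℕ j)
toℕ-punchIn-> zero    j       _ = refl
toℕ-punchIn-> (suc i) (suc j) p = cong suc (toℕ-punchIn-> i j (s<s⁻¹ p))

δ-punchIn : ∀ (I : TwoSubset (suc n)) j → δ I (punchIn (max I) j) ≡ j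
δ-punchIn I j with <-cmp (punchIn (max I) j) (max I)
... | tri< lt _ _ = toℕ-injective (trans (toℕ-fromℕ< _) (toℕ-punchIn-< (max I) j lt))
... | tri≈ _ eq _ = contradiction eq (punchInᵢ≢i (max I) j)
... | tri> _ _ gt = toℕ-injective (trans (toℕ-fromℕ< _) (cong (_∸ 1) (toℕ-punchIn-> (max I) j gt)))

δ-max : ∀ (I : TwoSubset n) → δ I (max I) ≡ δ I (min I)
δ-max I with <-cmp (max I) (max I) | <-cmp (min I) (max I)
... | tri< lt _ _ | _           = contradiction lt (<-irrefl refl)
... | tri> _ _ gt | _           = contradiction gt (<-irrefl refl)
... | tri≈ _ _ _  | tri< _ _ _  = toℕ-injective (trans (toℕ-fromℕ< _) (sym (toℕ-fromℕ< _)))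
... | tri≈ _ _ _  | tri≈ ≮ _ _  = contradiction (min<max I) ≮
... | tri≈ _ _ _  | tri> ≮ _ _  = contradiction (min<max I) ≮

-- Deleting the entry at `max J` loses nothing: `δ J` fills the gap with the equal entry at `min J`.
-- Thus the minor at `J` knows the function on all such tuples.
factor-δ : ∀ {A : Set a} (J : TwoSubset (suc n)) (u : Vec A (suc n)) →
           lookup u (min J) ≡ lookup u (max J) → (u · punchIn (max J)) · δ J ≡ u
factor-δ J u eq = trans (tabulate-cong pointwise) (tabulate∘lookup u)
  where
  open ≡-Reasoning

  off-max : ∀ t → max J ≢ t → lookup (u · punchIn (max J)) (δ J t) ≡ lookup u t
  off-max t max≢t = begin
    lookup (u · punchIn (max J)) (δ J t)
      ≡⟨ lookup∘tabulate _ (δ J t) ⟩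
    lookup u (punchIn (max J) (δ J t))
      ≡⟨ cong (lookup u ∘ punchIn (max J) ∘ δ J) (punchIn-punchOut max≢t) ⟨
    lookup u (punchIn (max J) (δ J (punchIn (max J) (punchOut max≢t))))
      ≡⟨ cong (lookup u ∘ punchIn (max J)) (δ-punchIn J (punchOut max≢t)) ⟩
    lookup u (punchIn (max J) (punchOut max≢t))
      ≡⟨ cong (lookup u) (punchIn-punchOut max≢t) ⟩
    lookup u t ∎

  pointwise : ∀ t → lookup (u · punchIn (max J)) (δ J t) ≡ lookup u t
  pointwise t with max J ≟ᶠ t
  ... | no  max≢t = off-max t max≢t
  ... | yes refl  = begin
    lookup (u · punchIn (max J)) (δ J (max J)) ≡⟨ cong (lookup (u · punchIn (max J))) (δ-max J) ⟩
    lookup (u · punchIn (max J)) (δ J (min J)) ≡⟨ off-max (min J) (≢-sym (<⇒≢ (min<max J))) ⟩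
    lookup u (min J)                           ≡⟨ eq ⟩
    lookup u (max J)                           ∎

-- Send 0 to `s zero`, remove that value and recurse. This serves to move a few distinct indices to
-- the front, where they become numerals.
extendToPermutation : ∀ {k} (s : Fin k → Fin (k + m)) → (∀ {i j} → s i ≡ s j → i ≡ j) →
                      ∃ λ (π : Permutation′ (k + m)) → ∀ i → π ⟨$⟩ʳ (i ↑ˡ m) ≡ s i
extendToPermutation {k = zero}  s inj = id , λ ()
extendToPermutation {m = m} {k = suc k} s inj = insert zero (s zero) (proj₁ rest) , λ where
    zero    → refl
    (suc i) → trans (insert-punchIn zero (s zero) (proj₁ rest) (i ↑ˡ m))
                (trans (cong (punchIn (s zero)) (proj₂ rest i)) (punchIn-punchOut (s0≢ i)))
  where
  s0≢ : ∀ i → s zero ≢ s (suc i)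
  s0≢ i eq with () ← inj eq

  rest : ∃ λ (π : Permutation′ (k + m)) → ∀ i → π ⟨$⟩ʳ (i ↑ˡ m) ≡ punchOut (s0≢ i)
  rest = extendToPermutation (λ i → punchOut (s0≢ i)) λ {i} {j} eq →
    case inj (punchOut-injective (s0≢ i) (s0≢ j) eq) of λ { refl → refl }

-- Parities of multiplicities.

module Odd {A : Set a} (_≟_ : DecidableEquality A) where

  -- Membership in `oddsupp` with values in the two-element ring, where changing entries becomes a
  -- linear operation.
  odd : Vec A n → A → Parity
  odd u x = parity (count (_≟ x) u)

  ind : A → A → Parity
  ind y = odd (y ∷ [])

  odd-∷ : ∀ y (u : Vec A n) x → odd (y ∷ u) x ≡ ind y x ℙ.+ odd u x
  odd-∷ y u x with does (y ≟ x)
  ... | false = refl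
  ... | true  = ℙ.+-homo-+ 1 (count (_≟ x) u)

  odd-tabulate : ∀ (t : Fin n → A) x → odd (tabulate t) x ≡ Σℙ (λ i → ind (t i) x)
  odd-tabulate {n = zero}  t x = refl
  odd-tabulate {n = suc n} t x =
    trans (odd-∷ (t zero) (tabulate (t ∘ suc)) x) (cong (ind (t zero) x ℙ.+_) (odd-tabulate (t ∘ suc) x))

  odd-lookup : ∀ (u : Vec A n) x → odd u x ≡ Σℙ (λ i → ind (lookup u i) x)
  odd-lookup u x = trans (cong (λ v → odd v x) (sym (tabulate∘lookup u))) (odd-tabulate (lookup u) x)

  odd-permute : ∀ (u : Vec A n) (π : Permutation′ n) x → odd (u · (π ⟨$⟩ʳ_)) x ≡ odd u x
  odd-permute u π x = trans (odd-tabulate (lookup u ∘ (π ⟨$⟩ʳ_)) x)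
    (trans (sym (sum-permute ℙ.+-0-commutativeMonoid (λ i → ind (lookup u i) x) π)) (sym (odd-lookup u x)))

  -- The indices other than `max I` reproduce `v` exactly once, and `max I` contributes one further
  -- copy of the identified entry.
  odd-δ : ∀ (I : TwoSubset (suc n)) (v : Vec A n) x →
          odd (v · δ I) x ≡ ind (lookup v (δ I (max I))) x ℙ.+ odd v x
  odd-δ I v x = begin
    odd (v · δ I) x
      ≡⟨ odd-tabulate (lookup v ∘ δ I) x ⟩
    Σℙ (λ i → ind (lookup v (δ I i)) x)
      ≡⟨ sum-remove ℙ.+-0-commutativeMonoid {i = max I} (λ i → ind (lookup v (δ I i)) x) ⟩
    ind (lookup v (δ I (max I))) x ℙ.+ Σℙ (λ j → ind (lookup v (δ I (punchIn (max I) j))) x)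
      ≡⟨ cong (at-max ℙ.+_)
             (sum-cong-≗ ℙ.+-0-commutativeMonoid λ j → cong (λ k → ind (lookup v k) x) (δ-punchIn I j)) ⟩
    ind (lookup v (δ I (max I))) x ℙ.+ Σℙ (λ j → ind (lookup v j) x)
      ≡⟨ cong (at-max ℙ.+_) (odd-lookup v x) ⟨
    ind (lookup v (δ I (max I))) x ℙ.+ odd v x ∎
    where
    open ≡-Reasoning
    at-max = ind (lookup v (δ I (max I))) x

  -- Removing the old value and adding the new one are both additions modulo 2.
  odd-update : ∀ (u : Vec A n) i {y} z → lookup u i ≡ y → ∀ x →
               odd (u [ i ]≔ z) x ≡ ind y x ℙ.+ ind z x ℙ.+ odd u x
  odd-update (y ∷ u) zero z refl x
    rewrite odd-∷ z u x | odd-∷ y u x =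
      solve 3 (λ y z u → z :+ u := y :+ z :+ (y :+ u)) refl (ind y x) (ind z x) (odd u x)
    where open ℙ-Solver
  odd-update (w ∷ u) (suc i) {y} z eq x
    rewrite odd-∷ w (u [ i ]≔ z) x | odd-∷ w u x | odd-update u i z eq x =
      solve 4 (λ w y z u → w :+ (y :+ z :+ u) := y :+ z :+ (w :+ u)) refl
        (ind w x) (ind y x) (ind z x) (odd u x)
    where open ℙ-Solver

  odd-update-≡ : ∀ (u : Vec A n) i {y z z′ o} x → lookup u i ≡ y → z ≡ z′ → odd u x ≡ o →
                 odd (u [ i ]≔ z) x ≡ ind y x ℙ.+ ind z′ x ℙ.+ o
  odd-update-≡ u i x eq refl refl = odd-update u i _ eq x

  _≐_ : Vec A n → Vec A n → Set _
  u ≐ v = ∀ x → odd u x ≡ odd v x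

-- On numerals, and on `4↑ k` against smaller numerals, this computes to the unit type, so the proof
-- can be left implicit.
Distinct : Vec (Fin n) m → Set
Distinct xs = True (allPairs? (λ i j → ¬? (i ≟ᶠ j)) xs)

distinct! : {xs : Vec (Fin n) m} {_ : Distinct xs} → Unique xs
distinct! {_} {_} {_} {distinct} = toWitness distinct

pattern 4↑ k = suc (suc (suc (suc k)))

lookup-overwritten : ∀ {A : Set a} {i j m} (u : Vec A n) (y z : A) → i ≢ j → i ≢ m →
                     lookup (u [ j ]≔ y [ m ]≔ z) i ≡ lookup u i
lookup-overwritten {j = j} u y z i≢j i≢m =
  trans (lookup∘update′ i≢m (u [ j ]≔ y) z) (lookup∘update′ i≢j u y)

-- Inessential arguments and insensitivity.

module Core {A : Set a} {B : Set b} (_≟_ : DecidableEquality A) {n : ℕ} (f : Vec A (4 + n) → B)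
            (f-cong : ∀ {u v} → Odd._≐_ _≟_ u v → f u ≡ f v) where

  open Odd _≟_
  open ≡-Reasoning

  -- On tuples with u i = u j, dropping u q from an oddsupp-determined function amounts to
  -- replacing u i by u q; q ∈ {i , j} is allowed and means g u = f u.
  Inessential : (Vec A (4 + n) → B) → (i j q : Fin (4 + n)) → Set _
  Inessential g i j q = ∀ u → lookup u i ≡ lookup u j → g u ≡ f (u [ i ]≔ lookup u q)

  InessentialEverywhere : (Vec A (4 + n) → B) → Set _
  InessentialEverywhere g = ∀ i j → i ≢ j → ∃ (Inessential g i j)

  Insensitive : (j m i l : Fin (4 + n)) → Set _
  Insensitive j m i l = ∀ u → lookup u j ≡ lookup u m → f (u [ i ]≔ lookup u l) ≡ f u

  inessential-sym : ∀ {g i j q} → Inessential g i j q → Inessential g j i q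
  inessential-sym {i = i} {j} {q} P u eq = trans (P u (sym eq)) (f-cong λ x →
    trans (odd-update u i (lookup u q) refl x) (sym (odd-update u j (lookup u q) eq x)))

  conjugate : ∀ {g i j q} (π : Permutation′ (4 + n)) → Inessential g i j q →
              Inessential (λ u → g (u · (π ⟨$⟩ʳ_))) (π ⟨$⟩ʳ i) (π ⟨$⟩ʳ j) (π ⟨$⟩ʳ q)
  conjugate {g} {i} {j} {q} π P u eq = trans (P v (trans (v≗ i) (trans eq (sym (v≗ j))))) (f-cong λ x →
    trans (odd-update-≡ v i x (v≗ i) (v≗ q) (odd-permute u π x))
          (sym (odd-update u (π ⟨$⟩ʳ i) (lookup u (π ⟨$⟩ʳ q)) refl x)))
    where
    v = u · (π ⟨$⟩ʳ_)

    v≗ : ∀ k → lookup v k ≡ lookup u (π ⟨$⟩ʳ k)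
    v≗ = lookup∘tabulate (lookup u ∘ (π ⟨$⟩ʳ_))

  -- Since `f` sees only parities, it is invariant under permutations of its arguments. All cases
  -- can therefore aim at one common conclusion about the first four indices.
  standardise : ∀ {j m i l} → Unique (j ∷ m ∷ i ∷ l ∷ []) → Insensitive j m i l → Insensitive 0F 1F 2F 3F
  standardise {j} {m} {i} {l} uniq insensitive u eq = begin
    f (u [ 2F ]≔ lookup u 3F)  ≡⟨ f-cong (λ x →
                                    trans (odd-update u 2F (lookup u 3F) refl x)
                                          (sym (odd-update-≡ v i x (v≗ 2F) (v≗ 3F) (odd-v x)))) ⟩
    f (v [ i ]≔ lookup v l)    ≡⟨ insensitive v (trans (v≗ 0F) (trans eq (sym (v≗ 1F)))) ⟩
    f v                        ≡⟨ f-cong odd-v ⟩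
    f u                        ∎
    where
    s = lookup (j ∷ m ∷ i ∷ l ∷ [])
    extension = extendToPermutation {m = n} s (λ {x} {y} → lookup-injective uniq x y)
    π = proj₁ extension
    v = u · (π ⟨$⟩ˡ_)

    odd-v : v ≐ u
    odd-v = odd-permute u (flip π)

    v≗ : ∀ k → lookup v (s k) ≡ lookup u (k ↑ˡ n)
    v≗ k = trans (lookup∘tabulate (lookup u ∘ (π ⟨$⟩ˡ_)) (s k))
      (cong (lookup u) (trans (cong (π ⟨$⟩ˡ_) (sym (proj₂ extension k))) (inverseˡ π)))

  -- Playing off two minors of the same function against each other.

  module _ {g : Vec A (4 + n) → B} where

    -- The tuple v has v i = v j and v k = v m, so g v can be computed in two ways.
    collide : ∀ {i j k m q r} → i ≢ j → i ≢ m → k ≢ j → k ≢ m → j ≢ m →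
              Inessential g i j q → Inessential g k m r →
              ∀ u → lookup u j ≡ lookup u m →
              let v = u [ j ]≔ lookup u i [ m ]≔ lookup u k in
              f (u [ k ]≔ lookup v q) ≡ f (u [ i ]≔ lookup v r)
    collide {i} {j} {k} {m} {q} {r} i≢j i≢m k≢j k≢m j≢m P R u eq = begin
      -- In passing from `u` to `v` the equal entries at `j` and `m` cancel, and `y` and `z` are
      -- added. Hence overwriting `y` in `v` has the same parities as overwriting `z` in `u`.
      f (u [ k ]≔ lookup v q)  ≡⟨ f-cong (λ x → trans (odd-update u k (lookup v q) refl x)
                                    (trans (solve 4 (λ y z w o → z :+ w :+ o := y :+ w :+ (y :+ z :+ o)) refl
                                              (ind y x) (ind z x) (ind (lookup v q) x) (odd u x))
                                           (sym (odd-update-≡ v i x v-i refl (odd-v x))))) ⟩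
      f (v [ i ]≔ lookup v q)  ≡⟨ P v (trans v-i (sym v-j)) ⟨
      g v                      ≡⟨ R v (trans v-k (sym v-m)) ⟩
      f (v [ k ]≔ lookup v r)  ≡⟨ f-cong (λ x → trans (odd-update-≡ v k x v-k refl (odd-v x))
                                    (trans (solve 4 (λ y z w o → z :+ w :+ (y :+ z :+ o) := y :+ w :+ o) refl
                                              (ind y x) (ind z x) (ind (lookup v r) x) (odd u x))
                                           (sym (odd-update u i (lookup v r) refl x)))) ⟩
      f (u [ i ]≔ lookup v r)  ∎
      where
      open ℙ-Solver using (solve; _:+_; _:=_)
      y = lookup u i
      z = lookup u k
      w = u [ j ]≔ y
      v = w [ m ]≔ z

      v-i : lookup v i ≡ y
      v-i = lookup-overwritten u y z i≢j i≢m

      v-j : lookup v j ≡ y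
      v-j = trans (lookup∘update′ j≢m w z) (lookup∘update j u y)

      v-k : lookup v k ≡ z
      v-k = lookup-overwritten u y z k≢j k≢m

      v-m : lookup v m ≡ z
      v-m = lookup∘update m w z

      odd-v : ∀ x → odd v x ≡ ind y x ℙ.+ ind z x ℙ.+ odd u x
      odd-v x = trans (odd-update-≡ w m x (lookup∘update′ (≢-sym j≢m) u y) refl
                         (odd-update-≡ u j x eq refl refl))
        (solve 4 (λ c y z o → c :+ z :+ (c :+ y :+ o) := y :+ z :+ o) refl
           (ind (lookup u m) x) (ind y x) (ind z x) (odd u x))

    -- This is `collide` with `k = i`: the tuple `v` has the value `u i` at `i`, `j` and `m`, so the
    -- description through `r` changes nothing, while the entry at `q` has survived from `u`.
    insensitive-triple : ∀ {i j m q r} → Unique (j ∷ m ∷ i ∷ q ∷ []) → r ∈ i ∷ j ∷ m ∷ [] →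
                         Inessential g i j q → Inessential g i m r → Insensitive j m i q
    insensitive-triple {i} {j} {m} {q} {r}
      ((j≢m ∷ j≢i ∷ j≢q ∷ []) ∷ (m≢i ∷ m≢q ∷ []) ∷ _) r∈ P R u eq = begin
        f (u [ i ]≔ lookup u q)  ≡⟨ cong (λ w → f (u [ i ]≔ w)) v-q ⟨
        f (u [ i ]≔ lookup v q)  ≡⟨ collide (≢-sym j≢i) (≢-sym m≢i) (≢-sym j≢i) (≢-sym m≢i) j≢m P R u eq ⟩
        f (u [ i ]≔ lookup v r)  ≡⟨ cong (λ w → f (u [ i ]≔ w)) (v-r r∈) ⟩
        f (u [ i ]≔ y)           ≡⟨ cong f ([]≔-lookup u i) ⟩
        f u                      ∎
      where
      y = lookup u i
      v = u [ j ]≔ y [ m ]≔ y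

      v-q : lookup v q ≡ lookup u q
      v-q = lookup-overwritten u y y (≢-sym j≢q) (≢-sym m≢q)

      v-r : r ∈ i ∷ j ∷ m ∷ [] → lookup v r ≡ y
      v-r (here refl)                 = lookup-overwritten u y y (≢-sym j≢i) (≢-sym m≢i)
      v-r (there (here refl))         = trans (lookup∘update′ j≢m (u [ j ]≔ y) y) (lookup∘update j u y)
      v-r (there (there (here refl))) = lookup∘update m (u [ j ]≔ y) y

    -- The argument `l` inessential for `{i , j}` belongs to the second pair, so one side of
    -- `collide` writes `u l` over itself and leaves `f u`. The other side writes over `u i`: the
    -- value `u l` if `r` is `m`, and `u r` otherwise.
    insensitive-disjoint : ∀ {i j l m r} → Unique (j ∷ m ∷ i ∷ l ∷ []) → r ≢ i → r ≢ j →
                           Inessential g i j l → Inessential g l m r → Insensitive 0F 1F 2F 3F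
    insensitive-disjoint {i} {j} {l} {m} {r}
      uniq@((j≢m ∷ j≢i ∷ j≢l ∷ []) ∷ (m≢i ∷ m≢l ∷ []) ∷ (i≢l ∷ []) ∷ _) r≢i r≢j P R =
        case r ≟ᶠ m of λ where
          (yes refl) → standardise uniq λ u eq →
            trans (cong (λ w → f (u [ i ]≔ w)) (sym (lookup∘update m (u [ j ]≔ lookup u i) (lookup u l))))
                  (reduce u eq)
          (no r≢m) → standardise
            ((j≢m ∷ j≢i ∷ ≢-sym r≢j ∷ []) ∷ (m≢i ∷ ≢-sym r≢m ∷ []) ∷ (≢-sym r≢i ∷ []) ∷ [] ∷ [])
            λ u eq → trans (cong (λ w → f (u [ i ]≔ w))
                              (sym (lookup-overwritten u (lookup u i) (lookup u l) r≢j r≢m)))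
                  (reduce u eq)
      where
      reduce : ∀ u → lookup u j ≡ lookup u m →
               f (u [ i ]≔ lookup (u [ j ]≔ lookup u i [ m ]≔ lookup u l) r) ≡ f u
      reduce u eq = begin
        f (u [ i ]≔ lookup v r)  ≡⟨ collide (≢-sym j≢i) (≢-sym m≢i) (≢-sym j≢l) (≢-sym m≢l) j≢m P R u eq ⟨
        f (u [ l ]≔ lookup v l)  ≡⟨ cong (λ w → f (u [ l ]≔ w)) v-l ⟩
        f (u [ l ]≔ lookup u l)  ≡⟨ cong f ([]≔-lookup u l) ⟩
        f u                      ∎
        where
        v = u [ j ]≔ lookup u i [ m ]≔ lookup u l

        v-l : lookup v l ≡ lookup u l
        v-l = lookup-overwritten u (lookup u i) (lookup u l) (≢-sym j≢l) (≢-sym m≢l)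

    triple : ∀ i j m q r {_ : Distinct (j ∷ m ∷ i ∷ q ∷ [])} {_ : True (_∈?_ _≟ᶠ_ r (i ∷ j ∷ m ∷ []))} →
             Inessential g i j q → Inessential g i m r → Insensitive 0F 1F 2F 3F
    triple _ _ _ _ _ {uniq} {r∈} P R =
      standardise (toWitness uniq) (insensitive-triple (toWitness uniq) (toWitness r∈) P R)

    module _ (inessential : InessentialEverywhere g)
             (P012 : Inessential g 0F 1F 2F) (P230 : Inessential g 2F 3F 0F) where

      P320 : Inessential g 3F 2F 0F
      P320 = inessential-sym P230

      P102 : Inessential g 1F 0F 2F
      P102 = inessential-sym P012

      -- Unless insensitivity follows at once, the inessential argument is forced to be 2 for
      -- {0 , 3}, 0 for {1 , 2} and a fifth index for {1 , 3}; then {0 , fifth} admits none.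
      insensitive-chain : Insensitive 0F 1F 2F 3F
      insensitive-chain = at03 (inessential 0F 3F λ ())
        where
        -- The digits in names such as `P032` are the pair followed by its inessential argument; 5
        -- stands for the index `4↑ k`.
        at05 : ∀ k → Inessential g 0F 3F 2F → Inessential g 1F 3F (4↑ k) →
               ∃ (Inessential g 0F (4↑ k)) → Insensitive 0F 1F 2F 3F
        at05 k P032 P135 (s , P05s) = case (s ≟ᶠ 1F) of λ where
          (yes refl) → triple 0F 1F (4↑ k) 2F 1F P012 P05s
          (no s≢1)   → case (s ≟ᶠ 3F) of λ where
            (yes refl) → triple 0F 3F (4↑ k) 2F 3F P032 P05s
            -- The fifth index is inessential for `{1 , 3}` and lies in the pair `{0 , fifth}`.
            (no s≢3)   → insensitive-disjoint distinct! s≢1 s≢3 P135 (inessential-sym P05s)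

        at13 : Inessential g 0F 3F 2F → Inessential g 1F 2F 0F →
               ∃ (Inessential g 1F 3F) → Insensitive 0F 1F 2F 3F
        at13 P032 P120 (0F , P) = triple 1F 0F 3F 2F 0F P102 P
        at13 P032 P120 (1F , P) = triple 1F 0F 3F 2F 1F P102 P
        at13 P032 P120 (2F , P) = triple 1F 2F 3F 0F 2F P120 P
        at13 P032 P120 (3F , P) = triple 1F 0F 3F 2F 3F P102 P
        at13 P032 P120 (4↑ k , P) = at05 k P032 P (inessential 0F (4↑ k) λ ())

        at12 : Inessential g 0F 3F 2F → ∃ (Inessential g 1F 2F) → Insensitive 0F 1F 2F 3F
        at12 P032 (0F , P) = at13 P032 P (inessential 1F 3F λ ())
        at12 P032 (1F , P) = triple 2F 3F 1F 0F 1F P230 (inessential-sym P)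
        at12 P032 (2F , P) = triple 2F 3F 1F 0F 2F P230 (inessential-sym P)
        at12 P032 (3F , P) = triple 2F 3F 1F 0F 3F P230 (inessential-sym P)
        at12 P032 (r@(4↑ _) , P) = triple 1F 2F 0F r 2F P P102

        at03 : ∃ (Inessential g 0F 3F) → Insensitive 0F 1F 2F 3F
        at03 (0F , P) = triple 0F 1F 3F 2F 0F P012 P
        at03 (1F , P) = triple 0F 1F 3F 2F 1F P012 P
        at03 (2F , P) = at12 P (inessential 1F 2F λ ())
        at03 (3F , P) = triple 0F 1F 3F 2F 3F P012 P
        -- Here the roles are exchanged: `{3 , 0}` has the outside argument `r`, and 0, inessential
        -- for `{3 , 2}`, lies among the three indices.
        at03 (r@(4↑ _) , P) = triple 3F 0F 2F r 0F (inessential-sym P) P320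

  -- Agreement of the two functions on tuples with a coincidence.

  conjugate-everywhere : ∀ {g} (π : Permutation′ (4 + n)) → InessentialEverywhere g →
                         InessentialEverywhere (λ u → g (u · (π ⟨$⟩ʳ_)))
  conjugate-everywhere {g} π inessential i j i≢j
    with q , P ← inessential (π ⟨$⟩ˡ i) (π ⟨$⟩ˡ j)
                   (λ eq → i≢j (trans (sym (inverseʳ π)) (trans (cong (π ⟨$⟩ʳ_) eq) (inverseʳ π))))
    = π ⟨$⟩ʳ q , subst₂ (λ x y → Inessential _ x y (π ⟨$⟩ʳ q)) (inverseʳ π) (inverseʳ π) (conjugate {g} π P)

  -- The pair `{2 , 3}` contains the argument inessential for `{0 , 1}`. If its own inessential
  -- argument lies outside `{0 , 1}`, then `insensitive-disjoint` applies; the other two cases need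
  -- the chain.
  insensitive : ∀ {g} → InessentialEverywhere g → Inessential g 0F 1F 2F → Insensitive 0F 1F 2F 3F
  insensitive {g} inessential P012 with inessential 2F 3F (λ ())
  ... | 0F , P = insensitive-chain inessential P012 P
  -- Exchanging 0 and 1 turns this case into the previous one; the conclusion concerns `f` alone, so
  -- `g` may be conjugated.
  ... | 1F , P = insensitive-chain (conjugate-everywhere τ inessential)
                   (conjugate {g} τ (inessential-sym P012)) (conjugate {g} τ P)
    where τ = transpose 0F 1F
  ... | 2F , P = insensitive-disjoint distinct! (λ ()) (λ ()) P012 P
  ... | 3F , P = insensitive-disjoint distinct! (λ ()) (λ ()) P012 P
  ... | 4↑ _ , P = insensitive-disjoint distinct! (λ ()) (λ ()) P012 P

  -- Writing `u 2` over `u 0` has the same parities as writing `u 0` over `u 2`. A change of entry 2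
  -- goes unnoticed, because both versions coincide once entry 2 is overwritten by entry 3.
  update-irrelevant : ∀ {g} → InessentialEverywhere g → Inessential g 0F 1F 2F →
                      ∀ u → lookup u 0F ≡ lookup u 1F → f (u [ 0F ]≔ lookup u 2F) ≡ f u
  update-irrelevant inessential P012 u@(x ∷ _ ∷ z ∷ w ∷ _) eq = begin
    f (u [ 0F ]≔ z)             ≡⟨ f-cong (λ c → trans (odd-update u 0F z refl c)
                                     (trans (cong (ℙ._+ odd u c) (ℙ.+-comm (ind x c) (ind z c)))
                                            (sym (odd-update u 2F x refl c)))) ⟩
    f (u [ 2F ]≔ x)             ≡⟨ insensitive inessential P012 (u [ 2F ]≔ x) eq ⟨
    f (u [ 2F ]≔ w)             ≡⟨ insensitive inessential P012 u eq ⟩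
    f u                         ∎

  inessential-irrelevant : ∀ {g i j q} → InessentialEverywhere g → Inessential g i j q →
                           Unique (i ∷ j ∷ q ∷ []) →
                           ∀ u → lookup u i ≡ lookup u j → f (u [ i ]≔ lookup u q) ≡ f u
  inessential-irrelevant {g} {i} {j} {q} inessential P uniq u eq = begin
    f (u [ i ]≔ lookup u q)    ≡⟨ f-cong (λ x → trans (odd-update u i (lookup u q) refl x)
                                    (sym (odd-update-≡ v 0F x (v≗ 0F) (v≗ 2F) (odd-permute u π x)))) ⟩
    f (v [ 0F ]≔ lookup v 2F)  ≡⟨ update-irrelevant (conjugate-everywhere {g} (flip π) inessential) P012 v
                                    (trans (v≗ 0F) (trans eq (sym (v≗ 1F)))) ⟩
    f v                        ≡⟨ f-cong (odd-permute u π) ⟩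
    f u                        ∎
    where
    s = lookup (i ∷ j ∷ q ∷ [])
    extension = extendToPermutation {m = suc n} s (λ {x} {y} → lookup-injective uniq x y)
    π = proj₁ extension
    v = u · (π ⟨$⟩ʳ_)

    v≗ : ∀ k → lookup v (k ↑ˡ suc n) ≡ lookup u (s k)
    v≗ k = trans (lookup∘tabulate (lookup u ∘ (π ⟨$⟩ʳ_)) (k ↑ˡ suc n)) (cong (lookup u) (proj₂ extension k))

    π⁻¹ : ∀ k → π ⟨$⟩ˡ s k ≡ k ↑ˡ suc n
    π⁻¹ k = trans (cong (π ⟨$⟩ˡ_) (sym (proj₂ extension k))) (inverseˡ π)

    h : Vec A (4 + n) → B
    h w = g (w · (π ⟨$⟩ˡ_))

    P012 : Inessential h 0F 1F 2F
    P012 = subst₂ (λ x y → Inessential h x y 2F) (π⁻¹ 0F) (π⁻¹ 1F)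
      (subst (Inessential h (π ⟨$⟩ˡ i) (π ⟨$⟩ˡ j)) (π⁻¹ 2F) (conjugate {g} (flip π) P))

  agree : ∀ {g} → InessentialEverywhere g → ∀ u i j → i ≢ j → lookup u i ≡ lookup u j → f u ≡ g u
  agree {g} inessential u i j i≢j eq
    with q , P ← inessential i j i≢j
    with q ≟ᶠ i | q ≟ᶠ j
  ... | yes refl | _        = sym (trans (P u eq) (cong f ([]≔-lookup u i)))
  ... | no _     | yes refl = sym (trans (P u eq)
    (cong f (trans (cong (u [ i ]≔_) (sym eq)) ([]≔-lookup u i))))
  ... | no q≢i   | no q≢j   = sym (trans (P u eq) (inessential-irrelevant inessential P
    ((i≢j ∷ ≢-sym q≢i ∷ []) ∷ (≢-sym q≢j ∷ []) ∷ [] ∷ []) u eq))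

  -- From equal decks to equal functions.

  -- In `w · δ I` the identified entry of `w` occurs once more than in `w`, so its parity
  -- contribution cancels and `minor f I` does not depend on it. The equivalence carries this over
  -- to `minor g J`.
  inessential-minor : ∀ {g} (I J : TwoSubset (4 + n)) → minor f I ≃ minor g J →
                      ∃ (Inessential g (min J) (max J))
  -- The witness is the position of the identified entry for `I`, carried back through `σ` and then
  -- into the index set of `u`.
  inessential-minor {g} I J (σ , f≃g) = punchIn (max J) (σ ⟨$⟩ˡ δ I (max I)) , λ u eq →
    let
      v = u · punchIn (max J)
      w = v · (σ ⟨$⟩ˡ_)
      q = punchIn (max J) (σ ⟨$⟩ˡ δ I (max I))

      wσ≡v : w · (σ ⟨$⟩ʳ_) ≡ v
      wσ≡v = trans (tabulate-cong λ k → trans (lookup∘tabulate (lookup v ∘ (σ ⟨$⟩ˡ_)) (σ ⟨$⟩ʳ k))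
                                              (cong (lookup v) (inverseˡ σ)))
                   (tabulate∘lookup v)

      w-max : lookup w (δ I (max I)) ≡ lookup u q
      w-max = trans (lookup∘tabulate (lookup v ∘ (σ ⟨$⟩ˡ_)) (δ I (max I)))
                    (lookup∘tabulate (lookup u ∘ punchIn (max J)) (σ ⟨$⟩ˡ δ I (max I)))

      v-max : lookup v (δ J (max J)) ≡ lookup u (min J)
      v-max = trans (sym (lookup∘tabulate (lookup v ∘ δ J) (max J)))
                    (trans (cong (λ t → lookup t (max J)) (factor-δ J u eq)) (sym eq))

      odd-u : ∀ x → odd u x ≡ ind (lookup u (min J)) x ℙ.+ odd v x
      odd-u x = trans (cong (λ t → odd t x) (sym (factor-δ J u eq)))
                      (trans (odd-δ J v x) (cong (λ y → ind y x ℙ.+ odd v x) v-max))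
    in begin
      g u                            ≡⟨ cong g (factor-δ J u eq) ⟨
      g (v · δ J)                    ≡⟨ cong (λ t → g (t · δ J)) wσ≡v ⟨
      g ((w · (σ ⟨$⟩ʳ_)) · δ J)      ≡⟨ f≃g w ⟨
      f (w · δ I)                    ≡⟨ f-cong (λ x →
        trans (odd-δ I w x)
        (trans (cong₂ (λ y o → ind y x ℙ.+ o) w-max (odd-permute v (flip σ) x))
        (trans (solve 3 (λ y z o → z :+ o := y :+ z :+ (y :+ o)) refl
                  (ind (lookup u (min J)) x) (ind (lookup u q) x) (odd v x))
               (sym (odd-update-≡ u (min J) x refl refl (odd-u x)))))) ⟩
      f (u [ min J ]≔ lookup u q)    ∎
    where open ℙ-Solver using (solve; _:+_; _:=_)

  inessentialEverywhere-reconstruction : ∀ {g} → g IsReconstructionOf f → InessentialEverywhere g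
  inessentialEverywhere-reconstruction {g} (π , matched) i j i≢j = case <-cmp i j of λ where
      (tri< i<j _ _) → atSubset (twoSubset i j i<j)
      (tri≈ _ i≡j _) → contradiction i≡j i≢j
      (tri> _ _ j<i) → let q , P = atSubset (twoSubset j i j<i) in q , inessential-sym P
    where
    atSubset : ∀ J → ∃ (Inessential g (min J) (max J))
    -- The matching runs from `deck f` to `deck g`, so the card of `g` at `J` is met at the preimage
    -- of `J`.
    atSubset J = inessential-minor (Inverse.from π J) J
      (subst (λ K → minor f (Inverse.from π J) ≃ minor g K) (Inverse.strictlyInverseˡ π J)
             (matched (Inverse.from π J)))

proposition3p11 : ∀ {a b : Level} {A : Set a} {B : Set b} →
    (∃₂ λ (x y : A) → x ≢ y) →
    (∃₂ λ (x y : B) → x ≢ y) →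
    ∀ (k : ℕ) (∣A∣=k : A ↔ Fin k) (n : ℕ) →
    k ⊔ 3 < n →
    (f : Vec A n → B) →
    DeterminedByOddsupp (inj⇒≟ (↔⇒↣ ∣A∣=k)) f →
    Reconstructible f
proposition3p11 _ _ k ∣A∣=k n k⊔3<n f (f* , f*-cong , f≗f*) g reconstruction
  -- The bound `3 < n` puts `n` into the form `4 + m`, which supplies the four named indices.
  with s≤s (s≤s (s≤s (s≤s (z≤n {m})))) ← m⊔n<o⇒n<o k 3 k⊔3<n
  -- The identity suffices: `f` and `g` agree on every tuple.
  = id , λ u →
    let i , j , i<j , eq = pigeonhole (m⊔n<o⇒m<o k 3 k⊔3<n) (Inverse.to ∣A∣=k ∘ lookup u)
    in trans (agree {g} (inessentialEverywhere-reconstruction {g} reconstruction) u i j (<⇒≢ i<j)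
                (Injection.injective (↔⇒↣ ∣A∣=k) eq))
             (cong g (sym (tabulate∘lookup u)))
  where
  _≟_ = inj⇒≟ (↔⇒↣ ∣A∣=k)

  f-cong : ∀ {u v} → Odd._≐_ _≟_ u v → f u ≡ f v
  f-cong {u} {v} u≐v = trans (f≗f* u)
    (trans (f*-cong λ x → cong (λ p → does (p ℙ.≟ 1ℙ)) (u≐v x)) (sym (f≗f* v)))

  open Core _≟_ f f-cong
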